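{- Let $1\le\beta\le\gamma$ with $\beta\gamma>1$, and let $\lambda>0$ satisfy $\lambda\le\frac{\gamma-1}{\beta-1}$ (when $\beta=1$ the right-hand side is read as $+\infty$, so the condition is vacuous). For any finite graph $G=(V,E)$ and any field $\pi:V\to\mathbb{R}^+$ with $\pi(v)\le\lambda$ for all $v\in V$, every vertex $v\in V$ satisfies $$p_v\le\frac{\lambda}{\lambda+1}.$$
   Context: For a finite graph $G=(V,E)$ and a field $\pi:V\to\mathbb{R}^+=(0,\infty)$, a configuration $\sigma:V\to\{0,1\}$ has weight $$w(\sigma)=\beta^{m_0(\sigma)}\gamma^{m_1(\sigma)}\prod_{v:\sigma(v)=0}\pi(v),$$ where $m_0(\sigma)$ (resp. $m_1(\sigma)$) is the number of edges of $G$ with both endpoints assigned $0$ (resp. $1$). The Gibbs measure assigns each $\sigma$ probability proportional to $w(\sigma)$, and $p_v$ is the probability that $\sigma(v)=0$ under the Gibbs measure of $G$. -}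

module Defs where

open import Algebra.Apartness.Bundles using (HeytingField)
open import Algebra.Apartness.Structures using (IsHeytingField)
open import Algebra.Bundles using (CommutativeRing; Semiring)
open import Algebra.Core using (Op₁; Op₂)
import Algebra.Definitions.RawSemiring as RawSemiringDefinitions
open import Data.Fin.Base as Fin using (Fin; zero; suc)
import Data.Fin.Properties as Fin
open import Data.List.Base using (List; length; filter; cartesianProduct; allFin)
open import Data.Nat.Base as ℕ using (ℕ; zero; suc)
open import Data.Product.Base using (Σ-syntax; _×_; _,_; proj₁)
open import Data.Sum.Base using (_⊎_; inj₁; inj₂)
open import Data.Vec.Functional using (Vector; []; _∷_)
open import Level using (Level; 0ℓ; _⊔_) renaming (suc to lsuc)
open import Relation.Binary.Core using (Rel)
open import Relation.Binary.Definitions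
  using (Cotransitive; Decidable; Symmetric; Irreflexive)
open import Relation.Binary.PropositionalEquality.Core using (_≡_)
open import Relation.Binary.Structures using (IsStrictPartialOrder)
open import Relation.Nullary.Decidable using (yes; no; _×-dec_)
open import Relation.Nullary.Negation using (¬_; contradiction)

-- The axioms are constructive: the apartness x # y is x < y ⊎ y < x, tight with
-- respect to _≈_, cotransitivity of _<_ takes the place of trichotomy, and x ≤ y
-- is the negation of y < x.
record OrderedField (c ℓ₁ ℓ₂ : Level) : Set (lsuc (c ⊔ ℓ₁ ⊔ ℓ₂)) where
  infix  8 -_
  infixl 7 _*_
  infixl 6 _+_
  infix  4 _≈_ _<_ _≤_
  field
    Carrier : Set c
    _≈_     : Rel Carrier ℓ₁
    _<_     : Rel Carrier ℓ₂
    _+_ _*_ : Op₂ Carrier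
    -_      : Op₁ Carrier
    0# 1#   : Carrier
    isHeytingField :
      IsHeytingField _≈_ (λ x y → x < y ⊎ y < x) _+_ _*_ -_ 0# 1#
    isStrictPartialOrder : IsStrictPartialOrder _≈_ _<_
    <-cotrans : Cotransitive _<_
    0<1       : 0# < 1#
    +-monoˡ-< : ∀ {x y} z → x < y → (x + z) < (y + z)
    *-pos     : ∀ {x y} → 0# < x → 0# < y → 0# < (x * y)

  heytingField : HeytingField c ℓ₁ ℓ₂
  heytingField = record { isHeytingField = isHeytingField }

  open IsHeytingField isHeytingField public
    using (isCommutativeRing; #⇒invertible; tight)

  commutativeRing : CommutativeRing c ℓ₁
  commutativeRing = record { isCommutativeRing = isCommutativeRing }

  open CommutativeRing commutativeRing public
    using (_-_; semiring; +-identityˡ; -‿inverseʳ)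

  open IsStrictPartialOrder isStrictPartialOrder public
    using (<-respˡ-≈; <-respʳ-≈)
    renaming (irrefl to <-irrefl; trans to <-trans; asym to <-asym)

  open RawSemiringDefinitions (Semiring.rawSemiring semiring) public
    using (_^_; product)
    renaming (_×_ to _·_)

  _≤_ : Rel Carrier ℓ₂
  x ≤ y = ¬ (y < x)

  -- The field axioms invert a difference of two apart elements, so the inverse
  -- of y is taken to be that of y - 0#.
  infixl 7 _/_⟨_⟩
  _/_⟨_⟩ : (x y : Carrier) → 0# < y → Carrier
  x / y ⟨ 0<y ⟩ = x * proj₁ (#⇒invertible {y} {0#} (inj₂ 0<y))

  <-≤-trans : ∀ {x y z} → x < y → y ≤ z → x < z
  <-≤-trans {z = z} x<y y≤z with <-cotrans x<y z
  ... | inj₁ x<z = x<z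
  ... | inj₂ z<y = contradiction z<y y≤z

  x<y⇒0<y-x : ∀ {x y} → x < y → 0# < (y - x)
  x<y⇒0<y-x {x} x<y = <-respˡ-≈ (-‿inverseʳ x) (+-monoˡ-< (- x) x<y)

  +-pos : ∀ {x y} → 0# < x → 0# < y → 0# < (x + y)
  +-pos {y = y} 0<x 0<y =
    <-trans 0<y (<-respˡ-≈ (+-identityˡ y) (+-monoˡ-< y 0<x))

  ^-pos : ∀ {x} n → 0# < x → 0# < (x ^ n)
  ^-pos zero    0<x = 0<1
  ^-pos (suc n) 0<x = *-pos 0<x (^-pos n 0<x)

  product-pos : ∀ {n} (f : Vector Carrier n) → (∀ i → 0# < f i) → 0# < product f
  product-pos {zero}  f 0<f = 0<1
  product-pos {suc n} f 0<f =
    *-pos (0<f zero) (product-pos (λ i → f (suc i)) (λ i → 0<f (suc i)))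

-- The real numbers, axiomatised as a Cauchy-complete Archimedean ordered field;
-- read classically, these axioms characterise ℝ up to isomorphism.
record Reals (c ℓ₁ ℓ₂ : Level) : Set (lsuc (c ⊔ ℓ₁ ⊔ ℓ₂)) where
  field
    orderedField : OrderedField c ℓ₁ ℓ₂

  open OrderedField orderedField public

  field
    archimedean : ∀ x → Σ[ n ∈ ℕ ] x < (n · 1#)
    complete    : (s : ℕ → Carrier) →
      (∀ ε → 0# < ε → Σ[ N ∈ ℕ ] (∀ j k → N ℕ.≤ j → N ℕ.≤ k → (s j - s k) < ε)) →
      Σ[ l ∈ Carrier ] (∀ ε → 0# < ε →
        Σ[ N ∈ ℕ ] (∀ k → N ℕ.≤ k → ((s k - l) < ε) × ((l - s k) < ε)))

record SimpleGraph (n : ℕ) : Set₁ where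
  field
    Adj        : Rel (Fin n) 0ℓ
    adj?       : Decidable Adj
    adj-sym    : Symmetric Adj
    adj-irrefl : Irreflexive _≡_ Adj

  -- Each undirected edge is listed once, as the pair (u , v) with u < v.
  edges : List (Fin n × Fin n)
  edges = filter (λ (u , v) → (u Fin.<? v) ×-dec adj? u v)
                 (cartesianProduct (allFin n) (allFin n))

Configuration : ℕ → Set
Configuration n = Fin n → Fin 2

module Gibbs
  {c ℓ₁ ℓ₂ : Level} (R : Reals c ℓ₁ ℓ₂) {n : ℕ} (G : SimpleGraph n)
  (β γ : Reals.Carrier R)
  (0<β : Reals._<_ R (Reals.0# R) β) (0<γ : Reals._<_ R (Reals.0# R) γ)
  (π : Fin n → Reals.Carrier R)
  (0<π : (v : Fin n) → Reals._<_ R (Reals.0# R) (π v))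
  where

  open Reals R
  open SimpleGraph G

  monochromatic : Fin 2 → Configuration n → ℕ
  monochromatic s σ =
    length (filter (λ (u , v) → (σ u Fin.≟ s) ×-dec (σ v Fin.≟ s)) edges)

  m₀ m₁ : Configuration n → ℕ
  m₀ = monochromatic zero
  m₁ = monochromatic (suc zero)

  fieldFactor : Configuration n → Fin n → Carrier
  fieldFactor σ v with σ v Fin.≟ zero
  ... | yes _ = π v
  ... | no  _ = 1#

  weight : Configuration n → Carrier
  weight σ = β ^ m₀ σ * γ ^ m₁ σ * product (fieldFactor σ)

  ∑ : ∀ {k} → (Configuration k → Carrier) → Carrier
  ∑ {zero}  f = f []
  ∑ {suc k} f = ∑ (λ σ → f (zero ∷ σ)) + ∑ (λ σ → f (suc zero ∷ σ))

  Z : Carrier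
  Z = ∑ weight

  fieldFactor-pos : ∀ σ v → 0# < fieldFactor σ v
  fieldFactor-pos σ v with σ v Fin.≟ zero
  ... | yes _ = 0<π v
  ... | no  _ = 0<1

  weight-pos : ∀ σ → 0# < weight σ
  weight-pos σ = *-pos (*-pos (^-pos (m₀ σ) 0<β) (^-pos (m₁ σ) 0<γ))
                       (product-pos (fieldFactor σ) (fieldFactor-pos σ))

  ∑-pos : ∀ {k} (f : Configuration k → Carrier) → (∀ σ → 0# < f σ) → 0# < ∑ f
  ∑-pos {zero}  f 0<f = 0<f []
  ∑-pos {suc k} f 0<f = +-pos (∑-pos _ (λ σ → 0<f (zero ∷ σ)))
                              (∑-pos _ (λ σ → 0<f (suc zero ∷ σ)))

  Z-pos : 0# < Z
  Z-pos = ∑-pos weight weight-pos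

  μ : Configuration n → Carrier
  μ σ = weight σ / Z ⟨ Z-pos ⟩

  restrictTo₀ : Fin n → (Configuration n → Carrier) → Configuration n → Carrier
  restrictTo₀ v f σ with σ v Fin.≟ zero
  ... | yes _ = f σ
  ... | no  _ = 0#

  p : Fin n → Carrier
  p v = ∑ (restrictTo₀ v μ)

{-# OPTIONS --safe #-}

-- An edge contributes 1 + B, where B is β - 1 or γ - 1 when its endpoints agree on
-- the spin 0 or 1 and vanishes otherwise.  Expanding the product over the edges
-- (the random cluster expansion) therefore either deletes an edge or contracts it,
-- with new vertex weights (a a' (β - 1) , c c' (γ - 1)).  The bound a ≤ λ c between
-- the two weights of a vertex survives a contraction because λ (β - 1) ≤ γ - 1, and
-- it survives the absorption of a loop because β ≤ γ; once no edge is left it gives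
-- Z₀ ≤ λ Z₁, where Z₀ and Z₁ are the parts of Z with σ(v) = 0 and σ(v) = 1.
module Submission where

open import Algebra.Bundles using (CommutativeRing)
import Algebra.Properties.Group as GroupProperties
import Algebra.Solver.Ring.NaturalCoefficients.Default as SemiringSolver
open import Data.Fin.Base using (Fin; zero; suc)
open import Data.Fin.Properties using (_≟_)
open import Data.List.Base using (List; []; _∷_; filter; length)
open import Data.Nat.Base using (ℕ; zero; suc)
open import Data.Product.Base using (_×_; _,_; proj₁)
open import Data.Sum.Base using (_⊎_; inj₁; inj₂; [_,_]′)
open import Data.Vec.Functional as Vector using (Vector; updateAt)
open import Data.Vec.Functional.Properties
  using (map-updateAt; updateAt-updates; updateAt-minimal)
open import Defs
open import Function.Base using (_∘_; const; id)
open import Level using (Level)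
open import Relation.Binary.PropositionalEquality as ≡ using (_≡_; _≢_; _≗_)
import Relation.Binary.Reasoning.Setoid as SetoidReasoning
open import Relation.Nullary.Decidable using (yes; no; _×-dec_)
open import Relation.Nullary.Negation using (¬_; contradiction)

-- Weak inequalities and division in a constructive ordered field.

module OrderedFieldProperties {c ℓ₁ ℓ₂ : Level} (F : OrderedField c ℓ₁ ℓ₂) where

  open OrderedField F
  open CommutativeRing commutativeRing
    using (refl; sym; trans; setoid; +-comm; +-congʳ; +-identityʳ;
           *-comm; *-assoc; *-congˡ; *-congʳ; *-identityʳ; zeroˡ; zeroʳ; distribˡ;
           +-group)
  open GroupProperties +-group using (//-rightDividesˡ; //-rightDividesʳ)
  open SetoidReasoning setoid

  <⇒≤ : ∀ {x y} → x < y → x ≤ y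
  <⇒≤ = <-asym

  ≤-reflexive : ∀ {x y} → x ≈ y → x ≤ y
  ≤-reflexive x≈y y<x = <-irrefl (sym x≈y) y<x

  ≤-trans : ∀ {x y z} → x ≤ y → y ≤ z → x ≤ z
  ≤-trans {y = y} x≤y y≤z z<x = [ y≤z , x≤y ]′ (<-cotrans z<x y)

  ≤-resp₂-≈ : ∀ {x x′ y y′} → x ≈ x′ → y ≈ y′ → x′ ≤ y′ → x ≤ y
  ≤-resp₂-≈ x≈x′ y≈y′ x′≤y′ =
    ≤-trans (≤-reflexive x≈x′) (≤-trans x′≤y′ (≤-reflexive (sym y≈y′)))

  -- Tightness turns the failure of both strict inequalities into equality. The case split is
  -- available only under double negation, which suffices whenever the goal is itself a weak
  -- inequality, hence a negation.
  ≤⇒¬¬<⊎≈ : ∀ {x y} → x ≤ y → ¬ ¬ (x < y ⊎ x ≈ y)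
  ≤⇒¬¬<⊎≈ {x} {y} x≤y ¬p =
    ¬p (inj₂ (proj₁ (tight x y) [ (λ x<y → ¬p (inj₁ x<y)) , x≤y ]′))

  +-cancelʳ-< : ∀ {x y} z → (x + z) < (y + z) → x < y
  +-cancelʳ-< {x} {y} z h =
    <-respˡ-≈ (//-rightDividesʳ z x)
      (<-respʳ-≈ (//-rightDividesʳ z y) (+-monoˡ-< (- z) h))

  +-monoˡ-≤ : ∀ {x y} z → x ≤ y → (x + z) ≤ (y + z)
  +-monoˡ-≤ z x≤y = x≤y ∘ +-cancelʳ-< z

  +-mono-≤ : ∀ {x y u v} → x ≤ y → u ≤ v → (x + u) ≤ (y + v)
  +-mono-≤ {x} {y} {u} {v} x≤y u≤v =
    ≤-trans (+-monoˡ-≤ u x≤y)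
      (≤-resp₂-≈ (+-comm y u) (+-comm y v) (+-monoˡ-≤ y u≤v))

  x≤y⇒0≤y-x : ∀ {x y} → x ≤ y → 0# ≤ (y - x)
  x≤y⇒0≤y-x {x} x≤y = ≤-resp₂-≈ (sym (-‿inverseʳ x)) refl (+-monoˡ-≤ (- x) x≤y)

  *-monoʳ-< : ∀ {x y} z → 0# < z → x < y → (z * x) < (z * y)
  *-monoʳ-< {x} {y} z 0<z x<y =
    <-respˡ-≈ (+-identityˡ (z * x))
      (<-respʳ-≈ (trans (sym (distribˡ z (y - x) x)) (*-congˡ (//-rightDividesˡ x y)))
        (+-monoˡ-< (z * x) (*-pos 0<z (x<y⇒0<y-x x<y))))

  *-monoʳ-≤ : ∀ {x y} z → 0# ≤ z → x ≤ y → (z * x) ≤ (z * y)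
  *-monoʳ-≤ {x} {y} z 0≤z x≤y zy<zx = ≤⇒¬¬<⊎≈ 0≤z
    [ (λ 0<z → ≤⇒¬¬<⊎≈ x≤y
        [ (λ x<y → <-asym zy<zx (*-monoʳ-< z 0<z x<y))
        , (λ x≈y → <-irrefl (*-congˡ (sym x≈y)) zy<zx) ]′)
    , (λ 0≈z → <-irrefl (trans (z*≈0 0≈z y) (sym (z*≈0 0≈z x))) zy<zx) ]′
    where
    z*≈0 : 0# ≈ z → ∀ w → z * w ≈ 0#
    z*≈0 0≈z w = trans (*-congʳ (sym 0≈z)) (zeroˡ w)

  *-mono-≤ : ∀ {x y u v} → 0# ≤ u → 0# ≤ y → x ≤ y → u ≤ v → (x * u) ≤ (y * v)
  *-mono-≤ {x} {y} {u} {v} 0≤u 0≤y x≤y u≤v =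
    ≤-trans (≤-resp₂-≈ (*-comm x u) (*-comm y u) (*-monoʳ-≤ u 0≤u x≤y))
      (*-monoʳ-≤ y 0≤y u≤v)

  *-nonneg : ∀ {x y} → 0# ≤ x → 0# ≤ y → 0# ≤ (x * y)
  *-nonneg {x} 0≤x 0≤y = ≤-resp₂-≈ (sym (zeroʳ x)) refl (*-monoʳ-≤ x 0≤x 0≤y)

  +-nonneg : ∀ {x y} → 0# ≤ x → 0# ≤ y → 0# ≤ (x + y)
  +-nonneg 0≤x 0≤y = ≤-resp₂-≈ (sym (+-identityˡ 0#)) refl (+-mono-≤ 0≤x 0≤y)

  /-*-cancel : ∀ x y (0<y : 0# < y) → y * (x / y ⟨ 0<y ⟩) ≈ x
  /-*-cancel x y 0<y with #⇒invertible {y} {0#} (inj₂ 0<y)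
  ... | y⁻¹ , y⁻¹y≈1 , _ = begin
    y * (x * y⁻¹)        ≈⟨ *-comm y (x * y⁻¹) ⟩
    x * y⁻¹ * y          ≈⟨ *-assoc x y⁻¹ y ⟩
    -- `#⇒invertible` supplies an inverse of `y - 0#`, so `y` is first brought into that form.
    x * (y⁻¹ * y)        ≈⟨ *-congˡ (*-congˡ (//-rightDividesʳ 0# y)) ⟨
    x * (y⁻¹ * (y + 0# - 0#)) ≈⟨ *-congˡ (*-congˡ (+-congʳ (+-identityʳ y))) ⟩
    x * (y⁻¹ * (y - 0#)) ≈⟨ *-congˡ y⁻¹y≈1 ⟩
    x * 1#               ≈⟨ *-identityʳ x ⟩
    x                    ∎

  /-≤-/ : ∀ {x y z w} (0<y : 0# < y) (0<w : 0# < w) →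
          (w * x) ≤ (y * z) → (x / y ⟨ 0<y ⟩) ≤ (z / w ⟨ 0<w ⟩)
  /-≤-/ {x} {y} {z} {w} 0<y 0<w wx≤yz z/w<x/y = wx≤yz
    (<-respˡ-≈ yw[z/w]≈yz (<-respʳ-≈ yw[x/y]≈wx
      (*-monoʳ-< (y * w) (*-pos 0<y 0<w) z/w<x/y)))
    where
    yw[z/w]≈yz : y * w * (z / w ⟨ 0<w ⟩) ≈ y * z
    yw[z/w]≈yz = trans (*-assoc y w _) (*-congˡ (/-*-cancel z w 0<w))
    yw[x/y]≈wx : y * w * (x / y ⟨ 0<y ⟩) ≈ w * x
    yw[x/y]≈wx = trans (*-congʳ (*-comm y w))
      (trans (*-assoc w y _) (*-congˡ (/-*-cancel x y 0<y)))

-- Stated inside the Gibbs parameters so that the sum ∑ of Gibbs can be used.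
module Cluster
  {c ℓ₁ ℓ₂ : Level} (R : Reals c ℓ₁ ℓ₂) {n : ℕ} (G : SimpleGraph n)
  (β γ : Reals.Carrier R)
  (0<β : Reals._<_ R (Reals.0# R) β) (0<γ : Reals._<_ R (Reals.0# R) γ)
  (π : Fin n → Reals.Carrier R)
  (0<π : (v : Fin n) → Reals._<_ R (Reals.0# R) (π v))
  where

  open Reals R
  open CommutativeRing commutativeRing
    using (refl; sym; trans; reflexive; setoid; commutativeSemiring; +-cong;
           +-congʳ; +-comm; *-cong; *-congˡ; *-congʳ; *-comm; *-assoc; *-identityˡ;
           *-identityʳ; +-identityʳ; zeroˡ; distribˡ; distribʳ; +-group)
  open GroupProperties +-group using (//-rightDividesˡ)
  open OrderedFieldProperties orderedField
  open Gibbs R G β γ 0<β 0<γ π 0<π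
  open SemiringSolver commutativeSemiring using (solve; _:=_; _:+_; _:*_; con)
  open SetoidReasoning setoid

  private variable
    k : ℕ

  -- Sums over configurations.

  Spin : Set
  Spin = Fin 2

  ∑-cong : {f g : Configuration k → Carrier} → (∀ τ → f τ ≈ g τ) → ∑ f ≈ ∑ g
  ∑-cong {zero}  f≈g = f≈g _
  ∑-cong {suc k} f≈g = +-cong (∑-cong {k} (λ τ → f≈g _)) (∑-cong {k} (λ τ → f≈g _))

  ∑-distrib-+ : (f g : Configuration k → Carrier) → ∑ (λ τ → f τ + g τ) ≈ ∑ f + ∑ g
  ∑-distrib-+ {zero}  f g = refl
  ∑-distrib-+ {suc k} f g =
    trans (+-cong (∑-distrib-+ {k} _ _) (∑-distrib-+ {k} _ _))
      (solve 4 (λ a b c d → (a :+ b) :+ (c :+ d) := (a :+ c) :+ (b :+ d)) refl _ _ _ _)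

  ∑-distribˡ-* : ∀ x (f : Configuration k → Carrier) → ∑ (λ τ → x * f τ) ≈ x * ∑ f
  ∑-distribˡ-* {zero}  x f = refl
  ∑-distribˡ-* {suc k} x f =
    trans (+-cong (∑-distribˡ-* {k} x _) (∑-distribˡ-* {k} x _)) (sym (distribˡ x _ _))

  ∑-nonneg : (f : Configuration k → Carrier) → (∀ τ → 0# ≤ f τ) → 0# ≤ ∑ f
  ∑-nonneg {zero}  f 0≤f = 0≤f _
  ∑-nonneg {suc k} f 0≤f =
    +-nonneg (∑-nonneg {k} _ (λ τ → 0≤f _)) (∑-nonneg {k} _ (λ τ → 0≤f _))

  δ : Spin → Spin → Carrier
  δ zero       zero       = 1#
  δ zero       (suc zero) = 0#
  δ (suc zero) zero       = 0#
  δ (suc zero) (suc zero) = 1#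

  -- Configurations are functions, and those produced by `updateAt`, by `∷` or by composition agree
  -- only pointwise; a summand must respect this agreement before it can be reindexed.
  Congruent : (Configuration k → Carrier) → Set _
  Congruent f = ∀ {σ τ} → σ ≗ τ → f σ ≈ f τ

  -- Sums out the spin at `y` while keeping the index type `Configuration k`: the factor
  -- `δ (suc zero) (τ y)` selects one representative `τ` for each assignment of spins to the other
  -- vertices. Vertices therefore never need renumbering.
  ∑-split : (y : Fin k) (f : Configuration k → Carrier) → Congruent f →
    ∑ f ≈ ∑ (λ τ → δ (suc zero) (τ y) * (f (updateAt τ y (const zero))
                                      + f (updateAt τ y (const (suc zero)))))
  ∑-split {suc k} zero f f-cong = begin
    ∑ f₀ + ∑ f₁                                   ≈⟨ ∑-distrib-+ f₀ f₁ ⟨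
    ∑ (λ τ → f₀ τ + f₁ τ)                         ≈⟨ ∑-cong step ⟩
    ∑ (λ τ → 0# * g (zero Vector.∷ τ) + 1# * g (suc zero Vector.∷ τ))
      ≈⟨ ∑-distrib-+ {k} _ _ ⟩
    ∑ (λ τ → 0# * g (zero Vector.∷ τ)) + ∑ (λ τ → 1# * g (suc zero Vector.∷ τ)) ∎
    where
    f₀ f₁ : Configuration k → Carrier
    f₀ τ = f (zero Vector.∷ τ)
    f₁ τ = f (suc zero Vector.∷ τ)
    g : Configuration (suc k) → Carrier
    g τ = f (updateAt τ zero (const zero)) + f (updateAt τ zero (const (suc zero)))
    head-updated : ∀ s t (τ : Configuration k) →
      s Vector.∷ τ ≗ updateAt (t Vector.∷ τ) zero (const s)
    head-updated s t τ zero    = ≡.refl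
    head-updated s t τ (suc i) = ≡.refl
    step : ∀ τ → f₀ τ + f₁ τ ≈ 0# * g (zero Vector.∷ τ) + 1# * g (suc zero Vector.∷ τ)
    step τ = begin
      f₀ τ + f₁ τ                  ≈⟨ +-cong (f-cong (head-updated _ _ τ))
                                             (f-cong (head-updated _ _ τ)) ⟩
      g (suc zero Vector.∷ τ)      ≈⟨ *-identityˡ _ ⟨
      1# * g (suc zero Vector.∷ τ) ≈⟨ +-identityˡ _ ⟨
      0# + 1# * g (suc zero Vector.∷ τ) ≈⟨ +-congʳ (zeroˡ _) ⟨
      0# * g (zero Vector.∷ τ) + 1# * g (suc zero Vector.∷ τ) ∎
  ∑-split {suc k} (suc y) f f-cong = +-cong (half zero) (half (suc zero))
    where
    tail-updated : ∀ s t (τ : Configuration k) →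
      s Vector.∷ updateAt τ y (const t) ≗ updateAt (s Vector.∷ τ) (suc y) (const t)
    tail-updated s t τ zero    = ≡.refl
    tail-updated s t τ (suc i) = ≡.refl
    ∷-cong : ∀ s {σ τ : Configuration k} → σ ≗ τ → s Vector.∷ σ ≗ s Vector.∷ τ
    ∷-cong s σ≗τ zero    = ≡.refl
    ∷-cong s σ≗τ (suc i) = σ≗τ i
    half : ∀ s → ∑ (λ τ → f (s Vector.∷ τ)) ≈
      ∑ (λ τ → δ (suc zero) (τ y)
             * (f (updateAt (s Vector.∷ τ) (suc y) (const zero))
              + f (updateAt (s Vector.∷ τ) (suc y) (const (suc zero)))))
    half s = trans (∑-split y (λ τ → f (s Vector.∷ τ)) (f-cong ∘ ∷-cong s))
      (∑-cong λ τ → *-congˡ (+-cong (f-cong (tail-updated s zero τ))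
                                    (f-cong (tail-updated s (suc zero) τ))))

  redirect : (x y : Fin k) → Fin k → Fin k
  redirect x y = updateAt id y (const x)

  updateAt≗redirect : ∀ (τ : Configuration k) {x y s} → τ x ≡ s →
    updateAt τ y (const s) ≗ τ ∘ redirect x y
  updateAt≗redirect τ {x} {y} ≡.refl i = ≡.sym (map-updateAt (λ _ → ≡.refl) id y i)

  -- Of the two terms that `∑-split` produces, only the one giving `y` the spin of `x` survives, and
  -- its configuration is `τ ∘ redirect x y`. Since `x ≢ y`, overwriting the spin at `y` leaves that
  -- of `x` intact.
  ∑-contract : {x y : Fin k} (f : Configuration k → Carrier) → Congruent f → x ≢ y →
    (∀ τ → τ x ≢ τ y → f τ ≈ 0#) →
    ∑ f ≈ ∑ (λ τ → δ (suc zero) (τ y) * f (τ ∘ redirect x y))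
  ∑-contract {k} {x} {y} f f-cong x≢y f-vanishes =
    trans (∑-split y f f-cong) (∑-cong (λ τ → *-congˡ (step τ)))
    where
    vanish : ∀ τ {s} → τ x ≢ s → f (updateAt τ y (const s)) ≈ 0#
    vanish τ {s} τx≢s = f-vanishes _ λ eq → τx≢s
      (≡.trans (≡.sym (updateAt-minimal x y τ x≢y)) (≡.trans eq (updateAt-updates y τ)))
    step : ∀ τ → f (updateAt τ y (const zero)) + f (updateAt τ y (const (suc zero)))
               ≈ f (τ ∘ redirect x y)
    step τ with τ x in eq
    ... | zero = trans
      (+-cong (f-cong (updateAt≗redirect τ eq))
              (vanish τ (λ eq′ → contradiction (≡.trans (≡.sym eq) eq′) λ ())))
      (+-identityʳ _)
    ... | suc zero = trans
      (+-cong (vanish τ (λ eq′ → contradiction (≡.trans (≡.sym eq) eq′) λ ()))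
              (f-cong (updateAt≗redirect τ eq)))
      (+-identityˡ _)

  -- Product weights on the vertices.

  VertexWeights : ℕ → Set c
  VertexWeights k = Vector (Spin → Carrier) k

  vertexWeight : VertexWeights k → Configuration k → Carrier
  vertexWeight h τ = product (λ i → h i (τ i))

  product-cong : {f g : Vector Carrier k} → (∀ i → f i ≈ g i) → product f ≈ product g
  product-cong {zero}  f≈g = refl
  product-cong {suc k} f≈g = *-cong (f≈g zero) (product-cong (f≈g ∘ suc))

  product-nonneg : (f : Vector Carrier k) → (∀ i → 0# ≤ f i) → 0# ≤ product f
  product-nonneg {zero}  f 0≤f = <⇒≤ 0<1
  product-nonneg {suc k} f 0≤f =
    *-nonneg (0≤f zero) (product-nonneg (f ∘ suc) (0≤f ∘ suc))

  vertexWeight-cong : (h : VertexWeights k) → Congruent (vertexWeight h)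
  vertexWeight-cong h σ≗τ = product-cong (λ i → reflexive (≡.cong (h i) (σ≗τ i)))

  scaleAt : Fin k → (Spin → Carrier) → VertexWeights k → VertexWeights k
  scaleAt x w h = updateAt h x (λ hₓ s → w s * hₓ s)

  -- Its `vertexWeight` is the product over the vertices other than `y`, obtained without shrinking
  -- the vertex set.
  eraseAt : Fin k → VertexWeights k → VertexWeights k
  eraseAt y h = updateAt h y (λ _ _ → 1#)

  vertexWeight-eraseAt : ∀ (y : Fin k) h τ →
    vertexWeight h τ ≈ h y (τ y) * vertexWeight (eraseAt y h) τ
  vertexWeight-eraseAt zero    h τ = *-congˡ (sym (*-identityˡ _))
  vertexWeight-eraseAt (suc y) h τ =
    trans (*-congˡ (vertexWeight-eraseAt y (h ∘ suc) (τ ∘ suc)))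
      (solve 3 (λ a b c → a :* (b :* c) := b :* (a :* c)) refl _ _ _)

  vertexWeight-updateAt : ∀ (y : Fin k) f h τ →
    vertexWeight (updateAt h y f) τ ≈ f (h y) (τ y) * vertexWeight (eraseAt y h) τ
  vertexWeight-updateAt zero    f h τ = *-congˡ (sym (*-identityˡ _))
  vertexWeight-updateAt (suc y) f h τ =
    trans (*-congˡ (vertexWeight-updateAt y f (h ∘ suc) (τ ∘ suc)))
      (solve 3 (λ a b c → a :* (b :* c) := b :* (a :* c)) refl _ _ _)

  vertexWeight-scaleAt : ∀ (x : Fin k) w h τ →
    vertexWeight (scaleAt x w h) τ ≈ w (τ x) * vertexWeight h τ
  vertexWeight-scaleAt x w h τ = trans (vertexWeight-updateAt x _ h τ)
    (trans (*-assoc _ _ _) (*-congˡ (sym (vertexWeight-eraseAt x h τ))))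

  vertexWeight-eraseAt-updateAt : ∀ (y : Fin k) h τ s →
    vertexWeight (eraseAt y h) (updateAt τ y s) ≈ vertexWeight (eraseAt y h) τ
  vertexWeight-eraseAt-updateAt zero    h τ s = refl
  vertexWeight-eraseAt-updateAt (suc y) h τ s =
    *-congˡ (vertexWeight-eraseAt-updateAt y (h ∘ suc) (τ ∘ suc) s)

  -- Edge interactions and the expansion of a single edge.

  interaction : Spin → Spin → Carrier
  interaction zero       zero       = β
  interaction zero       (suc zero) = 1#
  interaction (suc zero) zero       = 1#
  interaction (suc zero) (suc zero) = γ

  excess : Spin → Spin → Carrier
  excess zero       zero       = β - 1#
  excess zero       (suc zero) = 0#
  excess (suc zero) zero       = 0#
  excess (suc zero) (suc zero) = γ - 1#

  interaction≈1+excess : ∀ s t → interaction s t ≈ 1# + excess s t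
  interaction≈1+excess zero       zero       = sym (trans (+-comm _ _) (//-rightDividesˡ 1# β))
  interaction≈1+excess zero       (suc zero) = sym (+-identityʳ 1#)
  interaction≈1+excess (suc zero) zero       = sym (+-identityʳ 1#)
  interaction≈1+excess (suc zero) (suc zero) = sym (trans (+-comm _ _) (//-rightDividesˡ 1# γ))

  excess-off-diagonal : ∀ {s t} → s ≢ t → excess s t ≈ 0#
  excess-off-diagonal {zero}     {zero}     s≢t = contradiction ≡.refl s≢t
  excess-off-diagonal {zero}     {suc zero} s≢t = refl
  excess-off-diagonal {suc zero} {zero}     s≢t = refl
  excess-off-diagonal {suc zero} {suc zero} s≢t = contradiction ≡.refl s≢t

  edgeWeight : List (Fin n × Fin n) → Configuration n → Carrier
  edgeWeight []            σ = 1#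
  edgeWeight ((u , w) ∷ E) σ = interaction (σ u) (σ w) * edgeWeight E σ

  edgeWeight-cong : ∀ E → Congruent (edgeWeight E)
  edgeWeight-cong []            σ≗τ = refl
  edgeWeight-cong ((u , w) ∷ E) σ≗τ =
    *-cong (reflexive (≡.cong₂ interaction (σ≗τ u) (σ≗τ w))) (edgeWeight-cong E σ≗τ)

  -- Partition sums with one spin fixed, and their behaviour under contraction.

  Zₐₜ : Fin k → Spin → (Configuration k → Carrier) → Carrier
  Zₐₜ v s f = ∑ (λ τ → δ s (τ v) * f τ)

  Zₐₜ-cong : ∀ (v : Fin k) s {f g : Configuration k → Carrier} →
    (∀ τ → f τ ≈ g τ) → Zₐₜ v s f ≈ Zₐₜ v s g
  Zₐₜ-cong v s f≈g = ∑-cong (λ τ → *-congˡ (f≈g τ))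

  Zₐₜ-distrib-+ : ∀ (v : Fin k) s (f g : Configuration k → Carrier) →
    Zₐₜ v s (λ τ → f τ + g τ) ≈ Zₐₜ v s f + Zₐₜ v s g
  Zₐₜ-distrib-+ {k} v s f g =
    trans (∑-cong {k} (λ τ → distribˡ _ _ _)) (∑-distrib-+ {k} _ _)

  Zₐₜ-total : ∀ (v : Fin k) f → ∑ f ≈ Zₐₜ v zero f + Zₐₜ v (suc zero) f
  Zₐₜ-total {k} v f = trans (∑-cong {k} (λ τ → total (τ v) (f τ))) (∑-distrib-+ {k} _ _)
    where
    total : ∀ s x → x ≈ δ zero s * x + δ (suc zero) s * x
    total zero       = solve 1 (λ x → x := con 1 :* x :+ con 0 :* x) refl
    total (suc zero) = solve 1 (λ x → x := con 0 :* x :+ con 1 :* x) refl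

  -- Without edges the sum factorises over the vertices: fixing the spin of the first one leaves the
  -- others unconstrained.
  Zₐₜ-vertexWeight-zero : ∀ s (h : VertexWeights (suc k)) →
    Zₐₜ zero s (vertexWeight h) ≈ h zero s * ∑ (vertexWeight (h ∘ suc))
  Zₐₜ-vertexWeight-zero {k} s h =
    trans (+-cong (half zero) (half (suc zero))) (pick s)
    where
    S = ∑ (vertexWeight (h ∘ suc))
    half : ∀ t → ∑ (λ τ → δ s t * (h zero t * vertexWeight (h ∘ suc) τ))
                 ≈ δ s t * (h zero t * S)
    half t = trans (∑-distribˡ-* {k} _ _) (*-congˡ (∑-distribˡ-* {k} _ _))
    pick : ∀ s → δ s zero * (h zero zero * S) + δ s (suc zero) * (h zero (suc zero) * S)
               ≈ h zero s * S
    pick zero       = solve 2 (λ x y → con 1 :* x :+ con 0 :* y := x) refl _ _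
    pick (suc zero) = solve 2 (λ x y → con 0 :* x :+ con 1 :* y := y) refl _ _

  -- A vertex whose spin is free contributes the sum of its two weights, a factor that does not
  -- depend on `s`.
  Zₐₜ-vertexWeight-suc : ∀ (v : Fin k) s (h : VertexWeights (suc k)) →
    Zₐₜ (suc v) s (vertexWeight h)
      ≈ (h zero zero + h zero (suc zero)) * Zₐₜ v s (vertexWeight (h ∘ suc))
  Zₐₜ-vertexWeight-suc {k} v s h =
    trans (+-cong (half zero) (half (suc zero))) (sym (distribʳ _ _ _))
    where
    half : ∀ t → ∑ (λ τ → δ s (τ v) * (h zero t * vertexWeight (h ∘ suc) τ))
                 ≈ h zero t * Zₐₜ v s (vertexWeight (h ∘ suc))
    half t = trans
      (∑-cong {k} λ τ → solve 3 (λ a b c → a :* (b :* c) := b :* (a :* c)) refl _ _ _)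
      (∑-distribˡ-* {k} _ _)

  -- The merged vertex sits at x; y stays as an isolated vertex of weights (0 , 1), so
  -- that summing over its spin contributes a factor 1.
  isolateAt : Fin k → VertexWeights k → VertexWeights k
  isolateAt y h = updateAt h y (λ _ → δ (suc zero))

  contractWeights : (x y : Fin k) → VertexWeights k → VertexWeights k
  contractWeights x y h =
    scaleAt x (λ s → excess s s * h y s) (isolateAt y h)

  -- The excess vanishes unless `x` and `y` agree, so `∑-contract` applies. The factor
  -- `δ (suc zero) (τ y)` it creates is the weight `isolateAt` gives to `y`, and the old weight of
  -- `y` moves to `x`. The marked vertex passes through `redirect` because it may be `y` itself.
  Zₐₜ-contract : ∀ {x y : Fin k} v s h (f : Configuration k → Carrier) →
    Congruent f → x ≢ y →
    Zₐₜ v s (λ τ → vertexWeight h τ * (excess (τ x) (τ y) * f τ))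
      ≈ Zₐₜ (redirect x y v) s
          (λ τ → vertexWeight (contractWeights x y h) τ * f (τ ∘ redirect x y))
  Zₐₜ-contract {k} {x} {y} v s h f f-cong x≢y =
    trans (∑-contract F F-cong x≢y F-vanishes) (∑-cong step)
    where
    r = redirect x y
    F : Configuration k → Carrier
    F τ = δ s (τ v) * (vertexWeight h τ * (excess (τ x) (τ y) * f τ))
    F-cong : Congruent F
    F-cong σ≗τ = *-cong (reflexive (≡.cong (δ s) (σ≗τ v)))
      (*-cong (vertexWeight-cong h σ≗τ)
        (*-cong (reflexive (≡.cong₂ excess (σ≗τ x) (σ≗τ y))) (f-cong σ≗τ)))
    F-vanishes : ∀ τ → τ x ≢ τ y → F τ ≈ 0#
    F-vanishes τ τx≢τy = trans
      (*-congˡ (*-congˡ (*-congʳ (excess-off-diagonal τx≢τy))))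
      (solve 3 (λ a b c → a :* (b :* (con 0 :* c)) := con 0) refl _ _ _)
    rx≡x : r x ≡ x
    rx≡x = updateAt-minimal x y id x≢y
    ry≡x : r y ≡ x
    ry≡x = updateAt-updates y id
    module _ (τ : Configuration k) where
      H = vertexWeight (eraseAt y h) τ
      -- `τ ∘ r` can differ from `τ` only at `y`, where the erased product is blind to the spin.
      H[τ∘r] : vertexWeight h (τ ∘ r) ≈ h y (τ x) * H
      H[τ∘r] = begin
        vertexWeight h (τ ∘ r)
          ≈⟨ vertexWeight-eraseAt y h (τ ∘ r) ⟩
        h y (τ (r y)) * vertexWeight (eraseAt y h) (τ ∘ r)
          ≈⟨ *-cong (reflexive (≡.cong (h y ∘ τ) ry≡x))
                    (vertexWeight-cong (eraseAt y h)
                      (≡.sym ∘ updateAt≗redirect τ ≡.refl)) ⟩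
        h y (τ x) * vertexWeight (eraseAt y h) (updateAt τ y (const (τ x)))
          ≈⟨ *-congˡ (vertexWeight-eraseAt-updateAt y h τ _) ⟩
        h y (τ x) * H ∎
      H[contract] : vertexWeight (contractWeights x y h) τ
        ≈ excess (τ x) (τ x) * h y (τ x) * (δ (suc zero) (τ y) * H)
      H[contract] = trans (vertexWeight-scaleAt x _ _ τ)
        (*-congˡ (vertexWeight-updateAt y _ h τ))
      step : δ (suc zero) (τ y) * F (τ ∘ r)
        ≈ δ s (τ (r v)) * (vertexWeight (contractWeights x y h) τ * f (τ ∘ r))
      step = begin
        δ (suc zero) (τ y) * F (τ ∘ r)
          ≈⟨ *-congˡ (*-congˡ (*-cong H[τ∘r]
               (*-congʳ (reflexive (≡.cong₂ excess (≡.cong τ rx≡x) (≡.cong τ ry≡x)))))) ⟩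
        δ (suc zero) (τ y)
          * (δ s (τ (r v)) * (h y (τ x) * H * (excess (τ x) (τ x) * f (τ ∘ r))))
          ≈⟨ solve 6 (λ a b c d e f → a :* (b :* (c :* d :* (e :* f)))
                                   := b :* (e :* c :* (a :* d) :* f)) refl _ _ _ _ _ _ ⟩
        δ s (τ (r v))
          * (excess (τ x) (τ x) * h y (τ x) * (δ (suc zero) (τ y) * H) * f (τ ∘ r))
          ≈⟨ *-congˡ (*-congʳ H[contract]) ⟨
        δ s (τ (r v)) * (vertexWeight (contractWeights x y h) τ * f (τ ∘ r)) ∎

  -- The bound between the two weights of a vertex, and its preservation.

  module _ (1≤β : 1# ≤ β) (β≤γ : β ≤ γ) (λ₀ : Carrier) (0≤λ₀ : 0# ≤ λ₀)
           (λ₀[β-1]≤γ-1 : (λ₀ * (β - 1#)) ≤ (γ - 1#)) where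

    -- Nonnegativity rather than positivity is demanded: an isolated vertex has a weight 0, and
    -- `excess zero zero` is 0 when `β` is 1.
    record Bounded (w : Spin → Carrier) : Set ℓ₂ where
      field
        nonneg : ∀ s → 0# ≤ w s
        bound  : w zero ≤ (λ₀ * w (suc zero))
    open Bounded

    -- The inequality between the factors multiplies with the bound of `w′`, whose `λ₀` is then
    -- moved to the front. Loops and mergers are both instances.
    Bounded-scale : ∀ {w w′ : Spin → Carrier} → (∀ s → 0# ≤ w s) → w zero ≤ w (suc zero) →
      Bounded w′ → Bounded (λ s → w s * w′ s)
    Bounded-scale {w} {w′} 0≤w w₀≤w₁ B .nonneg s = *-nonneg (0≤w s) (B .nonneg s)
    Bounded-scale {w} {w′} 0≤w w₀≤w₁ B .bound = ≤-trans
      (*-mono-≤ (B .nonneg zero) (0≤w (suc zero)) w₀≤w₁ (B .bound))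
      (≤-reflexive (solve 3 (λ a b c → a :* (b :* c) := b :* (a :* c)) refl _ _ _))

    Bounded-loop : ∀ {w} → Bounded w → Bounded (λ s → interaction s s * w s)
    Bounded-loop = Bounded-scale
      (λ { zero → <⇒≤ 0<β ; (suc zero) → <⇒≤ 0<γ }) β≤γ

    excess-nonneg : ∀ s → 0# ≤ excess s s
    excess-nonneg zero       = x≤y⇒0≤y-x 1≤β
    excess-nonneg (suc zero) = x≤y⇒0≤y-x (≤-trans 1≤β β≤γ)

    -- The excess times `w′` serves as the scaling factor: the `λ₀` in the bound of `w′` is spent on
    -- turning `β - 1#` into `γ - 1#`, and the `λ₀` in the bound of `w` remains for the merged
    -- vertex.
    Bounded-merge : ∀ {w w′} → Bounded w → Bounded w′ →
      Bounded (λ s → excess s s * w′ s * w s)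
    Bounded-merge {w} {w′} B B′ = Bounded-scale
      (λ s → *-nonneg (excess-nonneg s) (B′ .nonneg s))
      (≤-trans (*-monoʳ-≤ _ (excess-nonneg zero) (B′ .bound))
        (≤-resp₂-≈ (solve 3 (λ a b c → a :* (b :* c) := c :* (b :* a)) refl _ _ _)
                   (*-comm _ _)
          (*-monoʳ-≤ _ (B′ .nonneg (suc zero)) λ₀[β-1]≤γ-1)))
      B

    Bounded-updateAt : ∀ (h : VertexWeights k) x f → (∀ i → Bounded (h i)) →
      Bounded (f (h x)) → ∀ i → Bounded (updateAt h x f i)
    Bounded-updateAt h zero    f B Bₓ zero    = Bₓ
    Bounded-updateAt h zero    f B Bₓ (suc i) = B (suc i)
    Bounded-updateAt h (suc x) f B Bₓ zero    = B zero
    Bounded-updateAt h (suc x) f B Bₓ (suc i) =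
      Bounded-updateAt (h ∘ suc) x f (B ∘ suc) Bₓ i

    Bounded-contract : ∀ (x y : Fin k) h → (∀ i → Bounded (h i)) →
      ∀ i → Bounded (contractWeights x y h i)
    Bounded-contract x y h B = Bounded-updateAt _ x _ B′ (Bounded-merge (B′ x) (B y))
      where
      B′ : ∀ i → Bounded (isolateAt y h i)
      -- The weights (0 , 1) satisfy the bound because `λ₀` is nonnegative.
      B′ = Bounded-updateAt h y _ B λ where
        .nonneg zero       → ≤-reflexive refl
        .nonneg (suc zero) → <⇒≤ 0<1
        .bound             → *-nonneg 0≤λ₀ (<⇒≤ 0<1)

    -- Domination of the two partition sums, by induction on the edges.

    Dominated : Fin k → (Configuration k → Carrier) → Set ℓ₂
    Dominated v f = Zₐₜ v zero f ≤ (λ₀ * Zₐₜ v (suc zero) f)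

    Dominated-resp-≈ : ∀ {v : Fin k} {f g} → (∀ τ → f τ ≈ g τ) →
      Dominated v g → Dominated v f
    Dominated-resp-≈ {v = v} f≈g =
      ≤-resp₂-≈ (Zₐₜ-cong v zero f≈g) (*-congˡ (Zₐₜ-cong v (suc zero) f≈g))

    Dominated-+ : ∀ {v : Fin k} {f g} → Dominated v f → Dominated v g →
      Dominated v (λ τ → f τ + g τ)
    Dominated-+ {v = v} {f} {g} f-dom g-dom =
      ≤-resp₂-≈ (Zₐₜ-distrib-+ v zero f g)
        (trans (*-congˡ (Zₐₜ-distrib-+ v (suc zero) f g)) (distribˡ _ _ _))
        (+-mono-≤ f-dom g-dom)

    -- By the factorisation, both sides share a nonnegative factor coming from the vertices other
    -- than `v`; what remains is the bound at `v`.
    vertexWeight-dominated : ∀ (h : VertexWeights k) → (∀ i → Bounded (h i)) →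
      ∀ v → Dominated v (vertexWeight h)
    vertexWeight-dominated h B zero =
      ≤-resp₂-≈ (trans (Zₐₜ-vertexWeight-zero zero h) (*-comm _ _))
        (trans (*-congˡ (Zₐₜ-vertexWeight-zero (suc zero) h))
          (solve 3 (λ a b c → a :* (b :* c) := c :* (a :* b)) refl _ _ _))
        (*-monoʳ-≤ _
          (∑-nonneg _ λ τ → product-nonneg _ λ i → B (suc i) .nonneg (τ i))
          (B zero .bound))
    vertexWeight-dominated h B (suc v) =
      ≤-resp₂-≈ (Zₐₜ-vertexWeight-suc v zero h)
        (trans (*-congˡ (Zₐₜ-vertexWeight-suc v (suc zero) h))
          (solve 3 (λ a b c → a :* (b :* c) := b :* (a :* c)) refl _ _ _))
        (*-monoʳ-≤ _ (+-nonneg (B zero .nonneg zero) (B zero .nonneg (suc zero)))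
          (vertexWeight-dominated (h ∘ suc) (B ∘ suc) v))

    -- ρ records which vertices of the original graph have been merged so far.
    dominated : ∀ E (h : VertexWeights k) → (∀ i → Bounded (h i)) →
      (ρ : Fin n → Fin k) → ∀ v →
      Dominated v (λ τ → vertexWeight h τ * edgeWeight E (τ ∘ ρ))
    dominated [] h B ρ v =
      Dominated-resp-≈ {v = v} (λ τ → *-identityʳ _) (vertexWeight-dominated h B v)
    dominated ((u , w) ∷ E) h B ρ v with ρ u ≟ ρ w
    -- The ends were merged earlier, so the edge is now a loop; its interaction depends on one spin
    -- only and becomes part of the weight at `ρ u`.
    ... | yes ρu≡ρw = Dominated-resp-≈ {v = v} absorb
      (dominated E (scaleAt (ρ u) (λ s → interaction s s) h)
        (Bounded-updateAt h (ρ u) _ B (Bounded-loop (B (ρ u)))) ρ v)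
      where
      absorb : ∀ τ →
        vertexWeight h τ * (interaction (τ (ρ u)) (τ (ρ w)) * edgeWeight E (τ ∘ ρ))
          ≈ vertexWeight (scaleAt (ρ u) (λ s → interaction s s) h) τ
            * edgeWeight E (τ ∘ ρ)
      absorb τ = begin
        vertexWeight h τ * (interaction (τ (ρ u)) (τ (ρ w)) * edgeWeight E (τ ∘ ρ))
          ≡⟨ ≡.cong (λ i → vertexWeight h τ
               * (interaction (τ (ρ u)) (τ i) * edgeWeight E (τ ∘ ρ))) ρu≡ρw ⟨
        vertexWeight h τ * (interaction (τ (ρ u)) (τ (ρ u)) * edgeWeight E (τ ∘ ρ))
          ≈⟨ solve 3 (λ a b c → a :* (b :* c) := b :* a :* c) refl _ _ _ ⟩
        interaction (τ (ρ u)) (τ (ρ u)) * vertexWeight h τ * edgeWeight E (τ ∘ ρ)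
          ≈⟨ *-congʳ (vertexWeight-scaleAt (ρ u) _ h τ) ⟨
        vertexWeight (scaleAt (ρ u) (λ s → interaction s s) h) τ * edgeWeight E (τ ∘ ρ) ∎
    -- The term 1 deletes the edge and the excess contracts it. Either way the edge list gets
    -- shorter, while contraction changes `h`, `ρ` and `v` together, so the induction is general in
    -- all three.
    ... | no ρu≢ρw = Dominated-resp-≈ {v = v} expand
      (Dominated-+ {v = v} (dominated E h B ρ v)
        (≤-resp₂-≈ (contract zero) (*-congˡ (contract (suc zero)))
          (dominated E (contractWeights (ρ u) (ρ w) h) (Bounded-contract _ _ h B)
            (redirect (ρ u) (ρ w) ∘ ρ) (redirect (ρ u) (ρ w) v))))
      where
      expand : ∀ τ →
        vertexWeight h τ * (interaction (τ (ρ u)) (τ (ρ w)) * edgeWeight E (τ ∘ ρ))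
          ≈ vertexWeight h τ * edgeWeight E (τ ∘ ρ)
            + vertexWeight h τ * (excess (τ (ρ u)) (τ (ρ w)) * edgeWeight E (τ ∘ ρ))
      expand τ = trans
        (*-congˡ (*-congʳ (interaction≈1+excess (τ (ρ u)) (τ (ρ w)))))
        (solve 3 (λ a b c → a :* ((con 1 :+ b) :* c) := a :* c :+ a :* (b :* c))
          refl _ _ _)
      contract = λ s → Zₐₜ-contract v s h (λ τ → edgeWeight E (τ ∘ ρ))
        (λ σ≗τ → edgeWeight-cong E (σ≗τ ∘ ρ)) ρu≢ρw

  -- The Gibbs weight and the marginal in terms of vertex and edge weights.

  ≢zero⇒≡one : {s : Spin} → s ≢ zero → s ≡ suc zero
  ≢zero⇒≡one {zero}     s≢0 = contradiction ≡.refl s≢0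
  ≢zero⇒≡one {suc zero} s≢0 = ≡.refl

  fieldWeights : VertexWeights n
  fieldWeights i zero       = π i
  fieldWeights i (suc zero) = 1#

  weight≈ : ∀ σ → weight σ ≈ vertexWeight fieldWeights σ * edgeWeight (SimpleGraph.edges G) σ
  weight≈ σ = trans (*-cong (edges≈ (SimpleGraph.edges G)) (product-cong field≈)) (*-comm _ _)
    where
    count : Spin → List (Fin n × Fin n) → ℕ
    count s E = length (filter (λ (u , v) → (σ u ≟ s) ×-dec (σ v ≟ s)) E)
    edges≈ : ∀ E → β ^ count zero E * γ ^ count (suc zero) E ≈ edgeWeight E σ
    edges≈ [] = *-identityˡ 1#
    -- Knowing both spins lets the two filters compute: the edge raises exactly one exponent, or
    -- neither.
    edges≈ ((u , w) ∷ E) with σ u | σ w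
    ... | zero     | zero     = trans (*-assoc _ _ _) (*-congˡ (edges≈ E))
    ... | zero     | suc zero = trans (edges≈ E) (sym (*-identityˡ _))
    ... | suc zero | zero     = trans (edges≈ E) (sym (*-identityˡ _))
    ... | suc zero | suc zero = trans
      (solve 3 (λ a b c → a :* (b :* c) := b :* (a :* c)) refl _ _ _)
      (*-congˡ (edges≈ E))
    field≈ : ∀ i → fieldFactor σ i ≈ fieldWeights i (σ i)
    field≈ i with σ i ≟ zero
    ... | yes σi≡0 = reflexive (≡.cong (fieldWeights i) (≡.sym σi≡0))
    ... | no  σi≢0 = reflexive (≡.cong (fieldWeights i) (≡.sym (≢zero⇒≡one σi≢0)))

  p≈ : ∀ v → p v ≈ (Zₐₜ v zero weight / Z ⟨ Z-pos ⟩)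
  p≈ v = trans (∑-cong {n} step) (trans (∑-distribˡ-* {n} _ _) (*-comm _ _))
    where
    Z⁻¹ = proj₁ (#⇒invertible {Z} {0#} (inj₂ Z-pos))
    step : ∀ σ → restrictTo₀ v μ σ ≈ Z⁻¹ * (δ zero (σ v) * weight σ)
    step σ with σ v ≟ zero
    ... | yes σv≡0 rewrite σv≡0 =
      solve 2 (λ a b → a :* b := b :* (con 1 :* a)) refl _ _
    ... | no  σv≢0 rewrite ≢zero⇒≡one σv≢0 =
      solve 2 (λ a b → con 0 := b :* (con 0 :* a)) refl (weight σ) _

proposition3p8 : ∀ {c ℓ₁ ℓ₂} (R : Reals c ℓ₁ ℓ₂) → let open Reals R in
    (β γ λ₀ : Carrier)
    (1≤β : 1# ≤ β) (β≤γ : β ≤ γ) (1<βγ : 1# < β * γ)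
    (0<λ₀ : 0# < λ₀)
    (λ₀≤ : (1<β : 1# < β) → λ₀ ≤ (γ - 1#) / (β - 1#) ⟨ x<y⇒0<y-x 1<β ⟩)
    {n : ℕ} (G : SimpleGraph n)
    (π : Fin n → Carrier) (0<π : ∀ v → 0# < π v) (π≤λ₀ : ∀ v → π v ≤ λ₀)
    (v : Fin n) →
    let 0<β = <-≤-trans 0<1 1≤β
        0<γ = <-≤-trans 0<β β≤γ
    in Gibbs.p R G β γ 0<β 0<γ π 0<π v ≤ λ₀ / (λ₀ + 1#) ⟨ +-pos 0<λ₀ 0<1 ⟩
proposition3p8 R β γ λ₀ 1≤β β≤γ 1<βγ 0<λ₀ λ₀≤ G π 0<π π≤λ₀ v = p≤
  where
  open Reals R
  open CommutativeRing commutativeRing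
    using (refl; sym; trans; commutativeSemiring; +-cong; *-cong; *-congˡ; *-comm;
           *-identityʳ; zeroʳ)
  open OrderedFieldProperties orderedField
  open SemiringSolver commutativeSemiring using (solve; _:=_; _:+_; _:*_; con)

  0<β : 0# < β
  0<β = <-≤-trans 0<1 1≤β

  0<γ : 0# < γ
  0<γ = <-≤-trans 0<β β≤γ

  open Gibbs R G β γ 0<β 0<γ π 0<π using (weight; Z; Z-pos; p)
  open Cluster R G β γ 0<β 0<γ π 0<π

  λ₀[β-1]≤γ-1 : (λ₀ * (β - 1#)) ≤ (γ - 1#)
  -- The goal is a negation, so `1≤β` may be split into `1# < β` and `1# ≈ β`. In the first case the
  -- quotient bound is cleared of its denominator; in the second, where no quotient is formed, the
  -- left side is 0 and `γ - 1#` is nonnegative.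
  λ₀[β-1]≤γ-1 γ-1<λ₀[β-1] = ≤⇒¬¬<⊎≈ 1≤β
    [ (λ 1<β → ≤-resp₂-≈ (*-comm _ _) (sym (/-*-cancel _ _ (x<y⇒0<y-x 1<β)))
        (*-monoʳ-≤ _ (x≤y⇒0≤y-x 1≤β) (λ₀≤ 1<β)) γ-1<λ₀[β-1])
    , (λ 1≈β → x≤y⇒0≤y-x (≤-trans 1≤β β≤γ)
        (<-respʳ-≈ (λ₀[β-1]≈0 1≈β) γ-1<λ₀[β-1])) ]′
    where
    λ₀[β-1]≈0 : 1# ≈ β → λ₀ * (β - 1#) ≈ 0#
    λ₀[β-1]≈0 1≈β =
      trans (*-congˡ (trans (+-cong (sym 1≈β) refl) (-‿inverseʳ 1#))) (zeroʳ λ₀)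

  Z₀ Z₁ : Carrier
  Z₀ = Zₐₜ v zero weight
  Z₁ = Zₐₜ v (suc zero) weight

  Z₀≤λ₀Z₁ : Z₀ ≤ (λ₀ * Z₁)
  Z₀≤λ₀Z₁ = Dominated-resp-≈ 1≤β β≤γ λ₀ (<⇒≤ 0<λ₀) λ₀[β-1]≤γ-1 weight≈
    -- Initially nothing is merged, so `ρ` is `id`, and the weights (π i , 1) satisfy the bound by
    -- `π≤λ₀`.
    (dominated 1≤β β≤γ λ₀ (<⇒≤ 0<λ₀) λ₀[β-1]≤γ-1 (SimpleGraph.edges G) fieldWeights
      (λ i → record
        { nonneg = λ { zero → <⇒≤ (0<π i) ; (suc zero) → <⇒≤ 0<1 }
        ; bound  = ≤-trans (π≤λ₀ i) (≤-reflexive (sym (*-identityʳ λ₀)))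
        }) id v)

  -- The claim with denominators cleared: since `Z` is the sum of `Z₀` and `Z₁`, it is `Z₀≤λ₀Z₁`
  -- with `λ₀ * Z₀` added to both sides.
  [λ₀+1]Z₀≤Zλ₀ : ((λ₀ + 1#) * Z₀) ≤ (Z * λ₀)
  [λ₀+1]Z₀≤Zλ₀ = ≤-resp₂-≈
    (solve 2 (λ l a → (l :+ con 1) :* a := a :+ l :* a) refl λ₀ Z₀)
    (trans (*-cong (Zₐₜ-total v weight) refl)
      (solve 3 (λ l a b → (a :+ b) :* l := l :* b :+ l :* a) refl λ₀ Z₀ Z₁))
    (+-mono-≤ Z₀≤λ₀Z₁ (≤-reflexive refl))

  p≤ : p v ≤ (λ₀ / (λ₀ + 1#) ⟨ +-pos 0<λ₀ 0<1 ⟩)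
  p≤ = ≤-trans (≤-reflexive (p≈ v)) (/-≤-/ Z-pos (+-pos 0<λ₀ 0<1) [λ₀+1]Z₀≤Zλ₀)
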